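{- Let $p_\Delta>0$ and $p_{min}<p_{max}$ be real numbers such that $(p_{max}-p_{min})/p_\Delta$ is an integer, and consider the multiresolution priority queue algorithm with these parameters (routines BUILD, INSERT, EXTRACT as given in the context). The INSERT and EXTRACT routines preserve the MR-PQ invariant. That is, if the data structure is in any state reachable from the state produced by BUILD by a finite sequence of valid INSERT and EXTRACT calls, and that state satisfies the MR-PQ invariant, then the state resulting from one further valid call to INSERT or EXTRACT also satisfies the MR-PQ invariant.
   Context: An element $e$ is a record with a real priority $e.prio$ and two pointers $e.next$, $e.prev$. Inserted elements are required to have priority in $[p_{min},p_{max})$. The data structure. Put $r=(p_{max}-p_{min})/p_\Delta$. The data structure consists of (i) a circular doubly linked list of elements containing a distinguished element $q$, the sentinel, which is never removed, and (ii) a lookup table $qlt$, an array indexed by $0,1,\dots,r$, each entry of which is NULL or a pointer to an element of the list. The slot of an element $e$ is $\mathrm{QltSlot}(e)=\lfloor (e.prio-q.prio)/p_\Delta\rfloor$. BUILD: set $q.next=q.prev=q$, $q.prio=p_{min}-p_\Delta$, $qlt[0]=q$, and $qlt[i]=$ NULL for $1\le i\le r$. INSERT($e$) (valid when $e$ is not currently in the list and $p_{min}\le e.prio<p_{max}$): let $s=\mathrm{QltSlot}(e)$ and let $s'$ be the largest index $s'\le s$ with $qlt[s']\ne$ NULL, found by starting at $s$ and decrementing by one. If $s'=s$, link $e$ into the list immediately before the element $qlt[s]$ (that is, between $qlt[s].prev$ and $qlt[s]$), leaving $qlt$ unchanged. If $s'<s$, link $e$ into the list immediately after the element $qlt[s']$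 (that is, between $qlt[s']$ and $qlt[s'].next$), and then set $qlt[s]=e$. EXTRACT($e$) (valid when $e$ is a non-sentinel element currently in the list): unlink $e$ from the list (set $e.prev.next=e.next$ and $e.next.prev=e.prev$). Then let $s=\mathrm{QltSlot}(e)$. If $qlt[s]\neq e$, do nothing more. Otherwise, if $\mathrm{QltSlot}(e.prev)=s$, set $qlt[s]=e.prev$; else set $qlt[s]=$ NULL. Elements are dequeued in list order, i.e. in the order obtained by following $next$ pointers starting at $q.next$ until $q$ is reached again. MR-PQ invariant: for any two elements $e_i,e_j$ (other than the sentinel) in the queue, with priorities $p_i,p_j\in[p_{min},p_{max})$, if $$\lfloor (p_i-p_{min})/p_\Delta\rfloor<\lfloor (p_j-p_{min})/p_\Delta\rfloor$$ then $e_i$ is dequeued before $e_j$. -}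

module Defs where

open import Level using (Level; _⊔_) renaming (suc to lsuc)
open import Algebra.Bundles using (CommutativeRing)
import Algebra.Definitions.RawMonoid as RawMonoidMult
import Algebra.Properties.Monoid.Mult as MonoidMult
import Algebra.Properties.Ring as RingProperties
import Relation.Binary.Reasoning.Setoid as SetoidReasoning
import Relation.Binary.Construct.StrictToNonStrict as StrictToNonStrict
open import Relation.Binary.Core using (Rel)
open import Relation.Binary.Definitions using (DecidableEquality; tri<; tri≈; tri>)
open import Relation.Binary.Structures using (IsStrictTotalOrder)
open import Relation.Binary.PropositionalEquality using (_≡_; _≢_)
open import Relation.Nullary using (¬_; does; yes; no)
open import Data.Bool using (if_then_else_)
open import Data.Empty using (⊥-elim)
open import Data.Nat as ℕ using (ℕ; zero; suc)
open import Data.Integer as ℤ using (ℤ; +_; -[1+_])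
open import Data.Fin as Fin using (Fin; zero; suc)
open import Data.Maybe using (Maybe; just; nothing; map; _<∣>_; _>>=_)
import Data.Maybe.Properties as Maybe
open import Data.Product using (∃; _×_; _,_; proj₁; proj₂)
open import Data.Sum using (_⊎_; inj₁; inj₂)

-- The real numbers, axiomatised as a complete ordered field, which
-- determines them up to isomorphism.  The logic is classical as far as the
-- order is concerned (trichotomy is decidable), so that the floor is a
-- function.
record RealNumbers (c ℓ : Level) : Set (lsuc (c ⊔ ℓ)) where
  infix  4 _<_
  infix  8 _⁻¹
  infixl 7 _/_

  field
    commutativeRing : CommutativeRing c ℓ

  open CommutativeRing commutativeRing public hiding (zero)

  field
    _<_                : Rel Carrier ℓ
    isStrictTotalOrder : IsStrictTotalOrder _≈_ _<_
    -- As usual for a totalised inverse, the value at 0# is unspecified.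
    _⁻¹                : Carrier → Carrier
    1≉0                : ¬ (1# ≈ 0#)
    ⁻¹-inverseʳ        : ∀ {x} → ¬ (x ≈ 0#) → x * x ⁻¹ ≈ 1#
    +-monoˡ-<          : ∀ z {x y} → x < y → x + z < y + z
    *-pos              : ∀ {x y} → 0# < x → 0# < y → 0# < x * y

  open IsStrictTotalOrder isStrictTotalOrder public
    using (compare; <-resp-≈; <-respˡ-≈; <-respʳ-≈; irrefl; asym)
    renaming (trans to <-trans)

  open StrictToNonStrict _≈_ _<_ public using (_≤_)
  open RawMonoidMult +-rawMonoid using () renaming (_×_ to _·_)

  fromℕ : ℕ → Carrier
  fromℕ n = n · 1#

  UpperBound : (Carrier → Set (c ⊔ ℓ)) → Carrier → Set (c ⊔ ℓ)
  UpperBound P u = ∀ x → P x → x ≤ u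

  field
    -- Classically a consequence of completeness; constructively the witness
    -- has to be given.
    archimedean : ∀ x → ∃ λ n → x < fromℕ n
    complete    : (P : Carrier → Set (c ⊔ ℓ)) → ∃ P → ∃ (UpperBound P) →
                  ∃ λ s → UpperBound P s × (∀ u → UpperBound P u → s ≤ u)

  fromℤ : ℤ → Carrier
  fromℤ (+ n)    = fromℕ n
  fromℤ -[1+ n ] = - fromℕ (suc n)

  _/_ : Carrier → Carrier → Carrier
  x / y = x * y ⁻¹

module Floor {c ℓ} (R : RealNumbers c ℓ) where
  open RealNumbers R
  open RingProperties ring using (-0#≈0#; -‿+-comm)
  open MonoidMult +-monoid using (×-homo-+)
  open SetoidReasoning setoid

  IsFloor : Carrier → ℤ → Set ℓ
  IsFloor x k = (fromℤ k ≤ x) × (x < fromℤ k + 1#)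

  fromℤ-suc : ∀ k → fromℤ k + 1# ≈ fromℤ (ℤ.suc k)
  fromℤ-suc (+ n)          = +-comm (fromℕ n) 1#
  fromℤ-suc -[1+ zero ]    = begin
    - (1# + 0#) + 1#  ≈⟨ +-congʳ (-‿cong (+-identityʳ 1#)) ⟩
    - 1# + 1#         ≈⟨ -‿inverseˡ 1# ⟩
    0#                ∎
  fromℤ-suc -[1+ suc n ]   = begin
    - (1# + y) + 1#      ≈⟨ +-congʳ (-‿cong (+-comm 1# y)) ⟩
    - (y + 1#) + 1#      ≈⟨ +-congʳ (-‿+-comm y 1#) ⟨
    (- y + - 1#) + 1#    ≈⟨ +-assoc (- y) (- 1#) 1# ⟩
    - y + (- 1# + 1#)    ≈⟨ +-congˡ (-‿inverseˡ 1#) ⟩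
    - y + 0#             ≈⟨ +-identityʳ (- y) ⟩
    - y                  ∎
    where y = fromℕ (suc n)

  fromℤ-neg : ∀ n → fromℤ (ℤ.- (+ n)) ≈ - fromℕ n
  fromℤ-neg zero    = sym -0#≈0#
  fromℤ-neg (suc n) = refl

  private
    search : ∀ x fuel k → fromℤ k ≤ x → x < fromℤ k + fromℕ fuel → ∃ (IsFloor x)
    search x zero k k≤x x<k+0 = ⊥-elim (contra k≤x)
      where
      x<k = <-respʳ-≈ (+-identityʳ (fromℤ k)) x<k+0
      contra : ¬ (fromℤ k ≤ x)
      contra (inj₁ k<x) = asym k<x x<k
      contra (inj₂ k≈x) = irrefl (sym k≈x) x<k
    search x (suc fuel) k k≤x x<k+f with compare x (fromℤ k + 1#)
    ... | tri< x<k+1 _ _ = k , k≤x , x<k+1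
    ... | tri≈ _ x≈k+1 _ = search x fuel (ℤ.suc k)
      (inj₂ (sym (trans x≈k+1 (fromℤ-suc k))))
      (<-respʳ-≈ (trans (sym (+-assoc _ _ _)) (+-congʳ (fromℤ-suc k))) x<k+f)
    ... | tri> _ _ k+1<x = search x fuel (ℤ.suc k)
      (inj₁ (<-respˡ-≈ (fromℤ-suc k) k+1<x))
      (<-respʳ-≈ (trans (sym (+-assoc _ _ _)) (+-congʳ (fromℤ-suc k))) x<k+f)

  floor-exists : ∀ x → ∃ (IsFloor x)
  floor-exists x with archimedean x | archimedean (- x)
  ... | n , x<n | m , -x<m = search x (m ℕ.+ n) (ℤ.- (+ m))
    (inj₁ (<-respˡ-≈ lower (<-respʳ-≈ upper (+-monoˡ-< (x + - m′) -x<m))))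
    (<-respʳ-≈ (sym span) x<n)
    where
    m′ = fromℕ m
    n′ = fromℕ n
    lower : - x + (x + - m′) ≈ fromℤ (ℤ.- (+ m))
    lower = begin
      - x + (x + - m′)   ≈⟨ +-assoc _ _ _ ⟨
      (- x + x) + - m′   ≈⟨ +-congʳ (-‿inverseˡ x) ⟩
      0# + - m′          ≈⟨ +-identityˡ _ ⟩
      - m′               ≈⟨ fromℤ-neg m ⟨
      fromℤ (ℤ.- (+ m))  ∎
    upper : m′ + (x + - m′) ≈ x
    upper = begin
      m′ + (x + - m′)    ≈⟨ +-comm _ _ ⟩
      (x + - m′) + m′    ≈⟨ +-assoc _ _ _ ⟩
      x + (- m′ + m′)    ≈⟨ +-congˡ (-‿inverseˡ m′) ⟩
      x + 0#             ≈⟨ +-identityʳ x ⟩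
      x                  ∎
    span : fromℤ (ℤ.- (+ m)) + fromℕ (m ℕ.+ n) ≈ n′
    span = begin
      fromℤ (ℤ.- (+ m)) + fromℕ (m ℕ.+ n)  ≈⟨ +-cong (fromℤ-neg m) (×-homo-+ 1# m n) ⟩
      - m′ + (m′ + n′)                     ≈⟨ +-assoc _ _ _ ⟨
      (- m′ + m′) + n′                     ≈⟨ +-congʳ (-‿inverseˡ m′) ⟩
      0# + n′                              ≈⟨ +-identityˡ n′ ⟩
      n′                                   ∎

  ⌊_⌋ : Carrier → ℤ
  ⌊ x ⌋ = proj₁ (floor-exists x)

  ⌊⌋-isFloor : ∀ x → IsFloor x ⌊ x ⌋
  ⌊⌋-isFloor x = proj₂ (floor-exists x)

update : ∀ {a b} {A : Set a} {B : Set b} → DecidableEquality A →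
         (A → B) → A → B → A → B
update _≟_ f a b x = if does (x ≟ a) then b else f x

-- The largest index at most the given one whose entry is not NULL, with that
-- entry; indices are tried in decreasing order.
scanDown : ∀ {a} {A : Set a} {n} → (Fin n → Maybe A) → Fin n → Maybe (Fin n × A)
scanDown t zero    = map (zero ,_) (t zero)
scanDown t (suc i) =
  map (λ (j , x) → suc j , x) (scanDown (λ k → t (suc k)) i) <∣> map (zero ,_) (t zero)

-- Elem is the type of pointers to elements, q the pointer to the sentinel.
module MRPQ {c ℓ a} (R : RealNumbers c ℓ)
            (Elem : Set a) (_≟_ : DecidableEquality Elem) (q : Elem)
            (pmin pmax pΔ : RealNumbers.Carrier R) (r : ℕ) where
  open RealNumbers R
  open Floor R

  -- The memory: the fields of every element, in the list or not, and the
  -- table.  NULL is nothing.  The pointer fields of an element that is not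
  -- in the list are arbitrary.
  record State : Set (c ⊔ a) where
    field
      prio : Elem → Carrier
      next : Elem → Elem
      prev : Elem → Elem
      qlt  : Fin (suc r) → Maybe Elem

  open State

  qltSlot : State → Elem → ℤ
  qltSlot σ e = ⌊ (prio σ e - prio σ q) / pΔ ⌋

  -- nothing: outside the bounds 0, …, r of the table.
  toIndex : ℤ → Maybe (Fin (suc r))
  toIndex -[1+ _ ] = nothing
  toIndex (+ n) with n ℕ.<? suc r
  ... | yes n<1+r = just (Fin.fromℕ< n<1+r)
  ... | no  _     = nothing

  setQlt : State → Fin (suc r) → Maybe Elem → State
  setQlt σ s m = record σ { qlt = update Fin._≟_ (qlt σ) s m }

  linkBetween : State → Elem → Elem → Elem → State
  linkBetween σ e x y = record σ
    { next = update _≟_ (update _≟_ (next σ) e y) x e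
    ; prev = update _≟_ (update _≟_ (prev σ) e x) y e
    }

  unlink : State → Elem → State
  unlink σ e = record σ
    { next = update _≟_ (next σ) (prev σ e) (next σ e)
    ; prev = update _≟_ (prev σ) (next σ e) (prev σ e)
    }

  -- The argument is the memory before the call; apart from the fields of q
  -- and the table it is left as it is.
  build : State → State
  build σ = record
    { prio = update _≟_ (prio σ) q (pmin - pΔ)
    ; next = update _≟_ (next σ) q q
    ; prev = update _≟_ (prev σ) q q
    ; qlt  = λ { zero → just q ; (suc _) → nothing }
    }

  -- The routines return nothing if they fault: a table access is out of
  -- bounds, or the search for s′ runs past index 0.
  insert : State → Elem → Maybe State
  insert σ e = do
    s        ← toIndex (qltSlot σ e)
    (s′ , x) ← scanDown (qlt σ) s
    just (if does (s′ Fin.≟ s)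
          then linkBetween σ e (prev σ x) x
          else setQlt (linkBetween σ e x (next σ x)) s (just e))

  extract : State → Elem → Maybe State
  extract σ e = do
    let σ₁ = unlink σ e
    s ← toIndex (qltSlot σ₁ e)
    just (if does (Maybe.≡-dec _≟_ (qlt σ₁ s) (just e))
          then (if does (qltSlot σ₁ (prev σ₁ e) ℤ.≟ qltSlot σ₁ e)
                then setQlt σ₁ s (just (prev σ₁ e))
                else setQlt σ₁ s nothing)
          else σ₁)

  -- DequeuedAt σ k e: e is the k-th element (from 0) met when following next
  -- pointers from q.next until q is reached again.
  data DequeuedAt (σ : State) : ℕ → Elem → Set a where
    first : ∀ {e} → next σ q ≡ e → e ≢ q → DequeuedAt σ zero e
    later : ∀ {k d e} → DequeuedAt σ k d → next σ d ≡ e → e ≢ q →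
            DequeuedAt σ (suc k) e

  InList : State → Elem → Set a
  InList σ e = e ≡ q ⊎ ∃ λ k → DequeuedAt σ k e

  InRange : Carrier → Set ℓ
  InRange p = (pmin ≤ p) × (p < pmax)

  data Call : Set a where
    INSERT EXTRACT : Elem → Call

  run : State → Call → Maybe State
  run σ (INSERT e)  = insert σ e
  run σ (EXTRACT e) = extract σ e

  data Valid (σ : State) : Call → Set (ℓ ⊔ a) where
    validInsert  : ∀ {e} → ¬ InList σ e → InRange (prio σ e) → Valid σ (INSERT e)
    validExtract : ∀ {e} → e ≢ q → InList σ e → Valid σ (EXTRACT e)

  data Reachable : State → Set (c ⊔ ℓ ⊔ a) where
    built  : ∀ σ → Reachable (build σ)
    called : ∀ {σ σ′} call → Reachable σ → Valid σ call →
             run σ call ≡ just σ′ → Reachable σ′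

  Invariant : State → Set (ℓ ⊔ a)
  Invariant σ = ∀ {i j eᵢ eⱼ} → DequeuedAt σ i eᵢ → DequeuedAt σ j eⱼ →
    InRange (prio σ eᵢ) → InRange (prio σ eⱼ) →
    ⌊ (prio σ eᵢ - pmin) / pΔ ⌋ ℤ.< ⌊ (prio σ eⱼ - pmin) / pΔ ⌋ → i ℕ.< j

{-# OPTIONS --safe #-}
module Submission where

-- The priority p_min − p_Δ of the sentinel makes QltSlot(e) one more than the
-- slot number in the MR-PQ invariant, and 1 ≤ QltSlot(e) ≤ r for insertable e.
-- In every reachable state the list, read from q, is sorted by QltSlot, and
-- qlt[i] is the last element of the list in slot i (NULL if there is none).
-- Hence INSERT always places e within, or at the end of, its slot: if
-- qlt[s] ≠ NULL just before the last element of slot s, otherwise just after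
-- the last element of the highest nonempty slot s′ < s.  EXTRACT keeps the list
-- sorted, and since the list is sorted, the predecessor of a removed last element
-- of a slot is the new last one unless the slot has become empty.

open import Defs
open import Data.Integer using (ℤ)
open import Data.Nat using (ℕ)
open import Data.Maybe.Relation.Unary.Any as Any using (Any)
open import Data.Product using (_,_; proj₂)
open import Relation.Binary.Definitions using (DecidableEquality)

-- Arithmetic of an ordered field and the floor function.

module FloorProperties {c ℓ} (R : RealNumbers c ℓ) where
  open RealNumbers R
  open Floor R
  open import Data.Empty using (⊥-elim)
  open import Data.Integer as ℤ using (+_)
  import Data.Integer.Properties as ℤ
  import Data.Nat as ℕ
  import Data.Nat.Properties as ℕ
  open import Data.Product using (∃; _×_; _,_; proj₁; proj₂)
  open import Data.Sum using (inj₁; inj₂)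
  open import Relation.Binary.Bundles using (StrictPartialOrder)
  open import Relation.Binary.Definitions using (tri<; tri≈; tri>)
  open import Relation.Binary.PropositionalEquality as ≡ using (_≡_)
  open import Relation.Binary.Structures using (IsStrictTotalOrder)
  open import Relation.Nullary using (yes; no)
  open import Algebra.Properties.Ring ring

  strictPartialOrder : StrictPartialOrder c ℓ ℓ
  strictPartialOrder = record
    { isStrictPartialOrder = IsStrictTotalOrder.isStrictPartialOrder isStrictTotalOrder }

  open import Relation.Binary.Reasoning.StrictPartialOrder strictPartialOrder

  +-monoˡ-≤ : ∀ z {x y} → x ≤ y → x + z ≤ y + z
  +-monoˡ-≤ z (inj₁ x<y) = inj₁ (+-monoˡ-< z x<y)
  +-monoˡ-≤ z (inj₂ x≈y) = inj₂ (+-congʳ x≈y)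

  x<y⇒0<y-x : ∀ {x y} → x < y → 0# < y - x
  x<y⇒0<y-x {x} x<y = <-respˡ-≈ (-‿inverseʳ x) (+-monoˡ-< (- x) x<y)

  0<y-x⇒x<y : ∀ {x y} → 0# < y - x → x < y
  0<y-x⇒x<y {x} {y} 0<y-x = begin-strict
    x             ≈⟨ +-identityˡ x ⟨
    0# + x        <⟨ +-monoˡ-< x 0<y-x ⟩
    y - x + x     ≈⟨ +-assoc y (- x) x ⟩
    y + (- x + x) ≈⟨ +-congˡ (-‿inverseˡ x) ⟩
    y + 0#        ≈⟨ +-identityʳ y ⟩
    y             ∎

  x<0⇒0<-x : ∀ {x} → x < 0# → 0# < - x
  x<0⇒0<-x x<0 = <-respʳ-≈ (+-identityˡ _) (x<y⇒0<y-x x<0)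

  -- Otherwise `- 1#` is positive, and hence so is its square, which is `1#`.
  0<1 : 0# < 1#
  0<1 with compare 0# 1#
  ... | tri< 0<1 _ _ = 0<1
  ... | tri≈ _ 0≈1 _ = ⊥-elim (1≉0 (sym 0≈1))
  ... | tri> _ _ 1<0 = begin-strict
    0#            <⟨ *-pos (x<0⇒0<-x 1<0) (x<0⇒0<-x 1<0) ⟩
    - 1# * - 1#   ≈⟨ -1*x≈-x (- 1#) ⟩
    - - 1#        ≈⟨ -‿involutive 1# ⟩
    1#            ∎

  x<x+1 : ∀ x → x < x + 1#
  x<x+1 x = begin-strict
    x       ≈⟨ +-identityˡ x ⟨
    0# + x  <⟨ +-monoˡ-< x 0<1 ⟩
    1# + x  ≈⟨ +-comm 1# x ⟩
    x + 1#  ∎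

  *-monoˡ-< : ∀ {x y z} → 0# < z → x < y → x * z < y * z
  *-monoˡ-< {x} {y} {z} 0<z x<y = 0<y-x⇒x<y (begin-strict
    0#                <⟨ *-pos (x<y⇒0<y-x x<y) 0<z ⟩
    (y - x) * z       ≈⟨ distribʳ z y (- x) ⟩
    y * z + - x * z   ≈⟨ +-congˡ (-‿distribˡ-* x z) ⟨
    y * z - x * z     ∎)

  *-monoˡ-≤ : ∀ {x y z} → 0# < z → x ≤ y → x * z ≤ y * z
  *-monoˡ-≤ 0<z (inj₁ x<y) = inj₁ (*-monoˡ-< 0<z x<y)
  *-monoˡ-≤ 0<z (inj₂ x≈y) = inj₂ (*-congʳ x≈y)

  x*x⁻¹≈1 : ∀ {x} → 0# < x → x * x ⁻¹ ≈ 1#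
  x*x⁻¹≈1 0<x = ⁻¹-inverseʳ (λ x≈0 → irrefl (sym x≈0) 0<x)

  -- Since `x * x ⁻¹ ≈ 1#`, a zero inverse would make `1#` zero and a negative one would make `- 1#`
  -- positive.
  ⁻¹-pos : ∀ {x} → 0# < x → 0# < x ⁻¹
  ⁻¹-pos {x} 0<x with compare 0# (x ⁻¹)
  ... | tri< 0<x⁻¹ _ _ = 0<x⁻¹
  ... | tri≈ _ 0≈x⁻¹ _ = ⊥-elim (1≉0 (begin-equality
    1#        ≈⟨ x*x⁻¹≈1 0<x ⟨
    x * x ⁻¹  ≈⟨ *-congˡ 0≈x⁻¹ ⟨
    x * 0#    ≈⟨ zeroʳ x ⟩
    0#        ∎))
  ... | tri> _ _ x⁻¹<0 = ⊥-elim (asym 0<1 (0<y-x⇒x<y (begin-strict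
    0#            <⟨ *-pos 0<x (x<0⇒0<-x x⁻¹<0) ⟩
    x * - (x ⁻¹)  ≈⟨ -‿distribʳ-* x (x ⁻¹) ⟨
    - (x * x ⁻¹)  ≈⟨ -‿cong (x*x⁻¹≈1 0<x) ⟩
    - 1#          ≈⟨ +-identityˡ (- 1#) ⟨
    0# - 1#       ∎)))

  fromℤ-≤-+ : ∀ n k → fromℤ k ≤ fromℤ (+ n ℤ.+ k)
  fromℤ-≤-+ ℕ.zero    k = inj₂ (reflexive (≡.cong fromℤ (≡.sym (ℤ.+-identityˡ k))))
  fromℤ-≤-+ (ℕ.suc n) k = begin
    fromℤ k                    ≤⟨ fromℤ-≤-+ n k ⟩
    fromℤ (+ n ℤ.+ k)          <⟨ x<x+1 _ ⟩
    fromℤ (+ n ℤ.+ k) + 1#     ≈⟨ fromℤ-suc (+ n ℤ.+ k) ⟩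
    fromℤ (ℤ.suc (+ n ℤ.+ k))  ≡⟨ ≡.cong fromℤ (ℤ.+-assoc (+ 1) (+ n) k) ⟨
    fromℤ (+ ℕ.suc n ℤ.+ k)    ∎

  fromℤ-mono-≤ : ∀ {k l} → k ℤ.≤ l → fromℤ k ≤ fromℤ l
  fromℤ-mono-≤ {k} {l} k≤l = begin
    fromℤ k                           ≤⟨ fromℤ-≤-+ ℤ.∣ l ℤ.- k ∣ k ⟩
    fromℤ (+ ℤ.∣ l ℤ.- k ∣ ℤ.+ k)     ≡⟨ ≡.cong (λ d → fromℤ (d ℤ.+ k)) (ℤ.0≤i⇒+∣i∣≡i (ℤ.i≤j⇒0≤j-i k≤l)) ⟩
    fromℤ (l ℤ.- k ℤ.+ k)             ≡⟨ ≡.cong fromℤ (≡.trans (ℤ.+-assoc l (ℤ.- k) k)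
                                          (≡.trans (≡.cong (λ d → l ℤ.+ d) (ℤ.+-inverseˡ k)) (ℤ.+-identityʳ l))) ⟩
    fromℤ l                           ∎

  -- If `l < k`, then `l + 1 ≤ k` as integers, and `x` would lie strictly below itself. This is the
  -- only place where discreteness of the integers enters.
  ≤-<+1⇒≤ : ∀ {x k l} → fromℤ k ≤ x → x < fromℤ l + 1# → k ℤ.≤ l
  ≤-<+1⇒≤ {x} {k} {l} k≤x x<l+1 with k ℤ.≤? l
  ... | yes k≤l = k≤l
  ... | no  k≰l = ⊥-elim (irrefl refl (begin-strict
    x                <⟨ x<l+1 ⟩
    fromℤ l + 1#     ≈⟨ fromℤ-suc l ⟩
    fromℤ (ℤ.suc l)  ≤⟨ fromℤ-mono-≤ (ℤ.i<j⇒suc[i]≤j (ℤ.≰⇒> k≰l)) ⟩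
    fromℤ k          ≤⟨ k≤x ⟩
    x                ∎))

  -- `⌊_⌋` is the outcome of a search that starts from an archimedean bound, so it is handled only
  -- through `IsFloor`, which determines the integer.
  isFloor-unique : ∀ {x k l} → IsFloor x k → IsFloor x l → k ≡ l
  isFloor-unique (k≤x , x<k+1) (l≤x , x<l+1) =
    ℤ.≤-antisym (≤-<+1⇒≤ k≤x x<l+1) (≤-<+1⇒≤ l≤x x<k+1)

  isFloor-suc : ∀ {x y k} → y ≈ x + 1# → IsFloor x k → IsFloor y (ℤ.suc k)
  isFloor-suc {x} {y} {k} y≈x+1 (k≤x , x<k+1) =
    (begin
      fromℤ (ℤ.suc k)  ≈⟨ fromℤ-suc k ⟨
      fromℤ k + 1#     ≤⟨ +-monoˡ-≤ 1# k≤x ⟩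
      x + 1#           ≈⟨ y≈x+1 ⟨
      y                ∎) ,
    (begin-strict
      y                     ≈⟨ y≈x+1 ⟩
      x + 1#                <⟨ +-monoˡ-< 1# x<k+1 ⟩
      fromℤ k + 1# + 1#     ≈⟨ +-congʳ (fromℤ-suc k) ⟩
      fromℤ (ℤ.suc k) + 1#  ∎)

  ⌊⌋-suc : ∀ {x y} → y ≈ x + 1# → ⌊ y ⌋ ≡ ℤ.suc ⌊ x ⌋
  ⌊⌋-suc {x} {y} y≈x+1 = isFloor-unique (⌊⌋-isFloor y) (isFloor-suc {k = ⌊ x ⌋} y≈x+1 (⌊⌋-isFloor x))

  ⌊⌋-zero : ∀ {x} → x ≈ 0# → ⌊ x ⌋ ≡ + 0
  ⌊⌋-zero {x} x≈0 = isFloor-unique (⌊⌋-isFloor x)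
    (inj₂ (sym x≈0) , <-respˡ-≈ (sym x≈0) (x<x+1 0#))

  ⌊⌋-bounds : ∀ {x n} → 0# ≤ x → x < fromℕ n → ∃ λ m → ⌊ x ⌋ ≡ + m × m ℕ.< n
  ⌊⌋-bounds {x} {n} 0≤x x<n = m , ≡.sym +m≡⌊x⌋ , m<n
    where
    m = ℤ.∣ ⌊ x ⌋ ∣
    +m≡⌊x⌋ : + m ≡ ⌊ x ⌋
    +m≡⌊x⌋ = ℤ.0≤i⇒+∣i∣≡i (≤-<+1⇒≤ 0≤x (proj₂ (⌊⌋-isFloor x)))
    m<n : m ℕ.< n
    m<n with m ℕ.<? n
    ... | yes m<n = m<n
    ... | no  m≮n = ⊥-elim (irrefl refl (begin-strict
      x            <⟨ x<n ⟩
      fromℤ (+ n)  ≤⟨ fromℤ-mono-≤ (ℤ.+≤+ (ℕ.≮⇒≥ m≮n)) ⟩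
      fromℤ (+ m)  ≡⟨ ≡.cong fromℤ +m≡⌊x⌋ ⟩
      fromℤ ⌊ x ⌋  ≤⟨ proj₁ (⌊⌋-isFloor x) ⟩
      x            ∎))

-- Pointwise update of a function.

module UpdateProperties {a b} {A : Set a} {B : Set b} (_≟_ : DecidableEquality A) where
  open import Data.Empty using (⊥-elim)
  open import Relation.Binary.PropositionalEquality using (_≡_; _≢_; refl)
  open import Relation.Nullary using (yes; no)

  update-≡ : (f : A → B) → ∀ {x y b} → x ≡ y → update _≟_ f y b x ≡ b
  update-≡ f {x} {y} x≡y with x ≟ y
  ... | yes _  = refl
  ... | no x≢y = ⊥-elim (x≢y x≡y)

  update-≢ : (f : A → B) → ∀ {x y b} → x ≢ y → update _≟_ f y b x ≡ f x
  update-≢ f {x} {y} x≢y with x ≟ y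
  ... | yes x≡y = ⊥-elim (x≢y x≡y)
  ... | no  _   = refl

-- The downward search in the table.

module ScanDownProperties {a} {A : Set a} where
  open import Data.Fin using (Fin; zero; suc; toℕ)
  open import Data.Maybe using (Maybe; just; nothing)
  open import Data.Nat using (suc; _≤_; _<_; z≤n; s≤s)
  open import Data.Product using (_×_; _,_)
  open import Relation.Binary.PropositionalEquality using (_≡_; refl)

  -- The two lemmas go together: an answer at index zero is the largest one only because the search
  -- above it failed.
  scanDown-just : ∀ {n} (t : Fin n → Maybe A) s {s′ x} → scanDown t s ≡ just (s′ , x) →
                  t s′ ≡ just x × toℕ s′ ≤ toℕ s ×
                  (∀ i → toℕ s′ < toℕ i → toℕ i ≤ toℕ s → t i ≡ nothing)
  scanDown-nothing : ∀ {n} (t : Fin n → Maybe A) s → scanDown t s ≡ nothing →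
                     ∀ i → toℕ i ≤ toℕ s → t i ≡ nothing

  scanDown-just t zero eq with t zero in t0
  scanDown-just t zero refl | just _ = t0 , z≤n , λ { zero () _ ; (suc _) _ () }
  scanDown-just t (suc s) eq with scanDown (λ k → t (suc k)) s in found
  scanDown-just t (suc s) refl | just _ with scanDown-just (λ k → t (suc k)) s found
  ... | ts′ , s′≤s , null = ts′ , s≤s s′≤s , λ where
    (suc i) (s≤s s′<i) (s≤s i≤s) → null i s′<i i≤s
  scanDown-just t (suc s) eq   | nothing with t zero in t0
  scanDown-just t (suc s) refl | nothing | just _ = t0 , z≤n , λ where
    (suc i) _ (s≤s i≤s) → scanDown-nothing (λ k → t (suc k)) s found i i≤s

  scanDown-nothing t zero    eq zero    _ with nothing ← t zero = refl
  scanDown-nothing t (suc s) eq i i≤s with scanDown (λ k → t (suc k)) s in found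
  scanDown-nothing t (suc s) eq (suc i) (s≤s i≤s) | nothing =
    scanDown-nothing (λ k → t (suc k)) s found i i≤s
  scanDown-nothing t (suc s) eq zero    _         | nothing with nothing ← t zero = refl

-- Lists: insertion behind an element, positions, chains of pointers.

module ListProperties {a} {A : Set a} where
  open import Data.List using (List; []; _∷_; _++_; head; initLast; _∷ʳ′_)
  open import Data.List.Membership.Propositional using (_∈_)
  open import Data.List.Properties using (++-assoc)
  open import Data.List.Relation.Unary.All as All using (All; []; _∷_)
  import Data.List.Relation.Unary.All.Properties as All
  open import Data.List.Relation.Unary.AllPairs using (AllPairs; []; _∷_)
  open import Data.List.Relation.Unary.Any using (here; there)
  open import Data.Maybe using (just; fromMaybe)
  open import Data.Maybe.Properties using (just-injective)
  open import Data.Empty using (⊥-elim)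
  open import Data.Nat using (zero; suc; _<_; z<s; s<s)
  open import Data.Product using (∃; ∃₂; _×_; _,_)
  open import Data.Sum using (_⊎_; inj₁; inj₂)
  open import Relation.Binary.Core using (Rel)
  open import Relation.Binary.PropositionalEquality
  open import Relation.Nullary using (¬_)

  private variable
    x y z : A
    xs ys zs : List A
    k : ℕ

  head-++-∷ : ∀ xs → head (xs ++ x ∷ ys) ≡ head (xs ++ x ∷ zs)
  head-++-∷ []      = refl
  head-++-∷ (_ ∷ _) = refl

  ∈-insert⁻ : ∀ xs → z ∈ xs ++ x ∷ y ∷ ys → z ≡ y ⊎ z ∈ xs ++ x ∷ ys
  ∈-insert⁻ []       (here z≡x)         = inj₂ (here z≡x)
  ∈-insert⁻ []       (there (here z≡y)) = inj₁ z≡y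
  ∈-insert⁻ []       (there (there z∈)) = inj₂ (there z∈)
  ∈-insert⁻ (w ∷ xs) (here z≡w)         = inj₂ (here z≡w)
  ∈-insert⁻ (w ∷ xs) (there z∈) with ∈-insert⁻ xs z∈
  ... | inj₁ z≡y = inj₁ z≡y
  ... | inj₂ z∈′ = inj₂ (there z∈′)

  ∈-insert⁺ : ∀ xs → z ∈ xs ++ x ∷ ys → z ∈ xs ++ x ∷ y ∷ ys
  ∈-insert⁺ []       (here z≡x) = here z≡x
  ∈-insert⁺ []       (there z∈) = there (there z∈)
  ∈-insert⁺ (x ∷ xs) (here z≡x) = here z≡x
  ∈-insert⁺ (x ∷ xs) (there z∈) = there (∈-insert⁺ xs z∈)

  -- Insertion and deletion are phrased relative to the element just in front. For an element other
  -- than the head, which will be the sentinel, such a neighbour exists.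
  ++-∷-before : ∀ xs → head (xs ++ y ∷ ys) ≡ just x → y ≢ x →
                ∃₂ λ zs z → xs ++ y ∷ ys ≡ zs ++ z ∷ y ∷ ys
  ++-∷-before xs hd y≢x with initLast xs
  ... | []       = ⊥-elim (y≢x (just-injective hd))
  ... | zs ∷ʳ′ z = zs , z , ++-assoc zs (z ∷ []) _

  module _ {ℓ} {R : Rel A ℓ} where
    allPairs-split : ∀ xs → AllPairs R (xs ++ y ∷ ys) → All (λ x → R x y) xs × All (R y) ys
    allPairs-split []       (ry ∷ _)  = [] , ry
    allPairs-split (x ∷ xs) (rx ∷ rs) with allPairs-split xs rs
    ... | rxs , rys = All.head (All.++⁻ʳ xs rx) ∷ rxs , rys

    -- Applied both to the slot order and to `_≢_`. The latter is not transitive, so the relation of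
    -- `y` to every element is asked for.
    allPairs-insert : ∀ xs → All (λ w → R w y) xs → R x y → All (R y) ys →
                      AllPairs R (xs ++ x ∷ ys) → AllPairs R (xs ++ x ∷ y ∷ ys)
    allPairs-insert []       []         rxy rys (rx ∷ rs) = (rxy ∷ rx) ∷ rys ∷ rs
    allPairs-insert (w ∷ xs) (rwy ∷ rwys) rxy rys (rw ∷ rs) with All.++⁻ xs rw
    ... | rwxs , rwx ∷ rwys′ =
      All.++⁺ rwxs (rwx ∷ rwy ∷ rwys′) ∷ allPairs-insert xs rwys rxy rys rs

    allPairs-delete : ∀ xs → AllPairs R (xs ++ x ∷ y ∷ ys) → AllPairs R (xs ++ x ∷ ys)
    allPairs-delete []       ((_ ∷ rx) ∷ _ ∷ rs) = rx ∷ rs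
    allPairs-delete (w ∷ xs) (rw ∷ rs) with All.++⁻ xs rw
    ... | rwxs , rwx ∷ _ ∷ rwys = All.++⁺ rwxs (rwx ∷ rwys) ∷ allPairs-delete xs rs

  infix 4 _[_]=_

  data _[_]=_ : List A → ℕ → A → Set a where
    here  : x ∷ xs [ zero ]= x
    there : xs [ k ]= y → x ∷ xs [ suc k ]= y

  []=⇒∈ : xs [ k ]= x → x ∈ xs
  []=⇒∈ here      = here refl
  []=⇒∈ (there p) = there ([]=⇒∈ p)

  ∈⇒[]= : x ∈ xs → ∃ λ k → xs [ k ]= x
  ∈⇒[]= (here refl) = zero , here
  ∈⇒[]= (there x∈) with ∈⇒[]= x∈
  ... | k , p = suc k , there p

  head⇒[]= : head xs ≡ just x → xs [ zero ]= x
  head⇒[]= {xs = _ ∷ _} refl = here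

  []=-functional : xs [ k ]= x → xs [ k ]= y → x ≡ y
  []=-functional here      here      = refl
  []=-functional (there p) (there p′) = []=-functional p p′

  -- With `i ≡ j` the elements would coincide, and with `j < i` the list would give `R y x`.
  allPairs⇒< : ∀ {ℓ} {R : Rel A ℓ} {i j} → AllPairs R xs → xs [ i ]= x → xs [ j ]= y →
               x ≢ y → ¬ R y x → i < j
  allPairs⇒< _          here      here      x≢y _    = ⊥-elim (x≢y refl)
  allPairs⇒< _          here      (there _) _   _    = z<s
  allPairs⇒< (rs ∷ _)   (there p) here      _   ¬ryx = ⊥-elim (¬ryx (All.lookup rs ([]=⇒∈ p)))
  allPairs⇒< (_  ∷ rss) (there p) (there p′) x≢y ¬ryx = s<s (allPairs⇒< rss p p′ x≢y ¬ryx)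

  -- The default of `fromMaybe` is the target of the last element, so a chain ending in the head of
  -- the list is a circle.
  data Chain (f : A → A) : List A → A → Set a where
    []  : Chain f [] y
    _∷_ : f x ≡ fromMaybe y (head xs) → Chain f xs y → Chain f (x ∷ xs) y

  module _ {f : A → A} where
    chain-++⁻ʳ : ∀ xs → Chain f (xs ++ ys) y → Chain f ys y
    chain-++⁻ʳ []       ch       = ch
    chain-++⁻ʳ (x ∷ xs) (_ ∷ ch) = chain-++⁻ʳ xs ch

    chain-∈ : Chain f xs y → x ∈ xs → f x ∈ xs ⊎ f x ≡ y
    chain-∈ {xs = _ ∷ []}    (fx ∷ _)  (here refl) = inj₂ fx
    chain-∈ {xs = _ ∷ _ ∷ _} (fx ∷ _)  (here refl) = inj₁ (there (here fx))
    chain-∈ {xs = _ ∷ _}     (_  ∷ ch) (there x∈) with chain-∈ ch x∈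
    ... | inj₁ fx∈ = inj₁ (there fx∈)
    ... | inj₂ fx≡ = inj₂ fx≡

    chain-[]=-suc : Chain f xs y → xs [ k ]= x → f x ≢ y → xs [ suc k ]= f x
    chain-[]=-suc {xs = _ ∷ []}    (fx ∷ _)  here fx≢y = ⊥-elim (fx≢y fx)
    chain-[]=-suc {xs = _ ∷ _ ∷ _} (fx ∷ _)  here _ rewrite fx = there here
    chain-[]=-suc (_ ∷ ch) (there p) fx≢y = there (chain-[]=-suc ch p fx≢y)

    chain-[]=-pred : Chain f xs y → xs [ suc k ]= x → ∃ λ z → xs [ k ]= z × f z ≡ x
    chain-[]=-pred (fz ∷ _) (there here) = _ , here , fz
    chain-[]=-pred (_ ∷ ch) (there p@(there _)) with chain-[]=-pred ch p
    ... | z , p′ , fz = z , there p′ , fz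

  module _ {f g : A → A} where
    chain-cong : (∀ {x} → x ∈ xs → f x ≡ g x) → Chain f xs y → Chain g xs y
    chain-cong f≗g []        = []
    chain-cong f≗g (fx ∷ ch) = trans (sym (f≗g (here refl))) fx ∷ chain-cong (λ x∈ → f≗g (there x∈)) ch

    -- Pointer surgery is local: both lists continue with `x` after `xs`, so the links of the prefix
    -- stay correct and only the part from `x` on has to be rebuilt.
    chain-replace : ∀ xs → (∀ {z} → z ∈ xs → f z ≡ g z) → Chain f (xs ++ x ∷ ys) y →
                    Chain g (x ∷ zs) y → Chain g (xs ++ x ∷ zs) y
    chain-replace []       _   _         new = new
    chain-replace (z ∷ xs) f≗g (fz ∷ ch) new =
      trans (sym (f≗g (here refl))) (trans fz (cong (fromMaybe _) (head-++-∷ xs)))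
      ∷ chain-replace xs (λ z∈ → f≗g (there z∈)) ch new

-- Circular doubly linked lists and their pointer surgery.

module CircularList {a} {A : Set a} (_≟_ : DecidableEquality A) (q : A) where
  open ListProperties {A = A}
  open UpdateProperties {B = A} _≟_
  open import Data.List using (List; []; _∷_; _++_; head)
  open import Data.List.Membership.Propositional using (_∈_; _∉_)
  open import Data.List.Membership.Propositional.Properties using (∈-++⁺ˡ; ∈-++⁺ʳ; ∈-++⁻)
  open import Data.List.Properties using (++-assoc)
  import Data.List.Relation.Unary.All as All
  open import Data.List.Relation.Unary.AllPairs using (AllPairs)
  open import Data.List.Relation.Unary.Any using (here; there)
  open import Data.Maybe using (just)
  open import Data.Product using (_×_; _,_; proj₁; proj₂)
  open import Data.Sum using (_⊎_; inj₁; inj₂)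
  open import Relation.Binary.PropositionalEquality
  open import Relation.Nullary using (yes; no)

  -- `M` lists the circle once, starting at the sentinel. `prev-next` determines `prev` on `M`,
  -- because every element is a successor, and makes `next` injective there.
  record Circular (next prev : A → A) (M : List A) : Set a where
    field
      starts    : head M ≡ just q
      chain     : Chain next M q
      prev-next : ∀ {x} → x ∈ M → prev (next x) ≡ x
      unique    : AllPairs _≢_ M

    q∈ : q ∈ M
    q∈ = []=⇒∈ (head⇒[]= starts)

    next-∈ : ∀ {x} → x ∈ M → next x ∈ M
    next-∈ x∈ with chain-∈ chain x∈
    ... | inj₁ nx∈ = nx∈
    ... | inj₂ nx≡q = subst (_∈ M) (sym nx≡q) q∈

  open Circular

  unique-split : ∀ xs {y ys} → AllPairs _≢_ (xs ++ y ∷ ys) →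
                 (∀ {z} → z ∈ xs → z ≢ y) × (∀ {z} → z ∈ ys → z ≢ y)
  unique-split xs u with allPairs-split xs u
  ... | l , r = All.lookup l , λ z∈ z≡y → All.lookup r z∈ (sym z≡y)

  module _ {next prev : A → A} where
    prev-between : ∀ xs {x e ys} → Circular next prev (xs ++ x ∷ e ∷ ys) →
                   next x ≡ e × prev e ≡ x
    prev-between xs ring with chain-++⁻ʳ xs (chain ring)
    ... | nx ∷ _ = nx , trans (cong prev (sym nx)) (prev-next ring (∈-++⁺ʳ xs (here refl)))

    -- `z` is described by `next x ≡ z` and not as the head of `ys`, which covers the case that `x`
    -- is last and `z` is the sentinel.
    circular-insert : ∀ xs {x e z ys} → Circular next prev (xs ++ x ∷ ys) →
                      e ∉ xs ++ x ∷ ys → next x ≡ z →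
                      Circular (update _≟_ (update _≟_ next e z) x e)
                               (update _≟_ (update _≟_ prev e x) z e)
                               (xs ++ x ∷ e ∷ ys)
    circular-insert xs {x} {e} {z} {ys} ring e∉ nx≡z = record
      { starts    = trans (head-++-∷ xs) (starts ring)
      ; chain     = chain-replace xs (λ w∈ → sym (next′-other (∈-++⁺ˡ w∈) (proj₁ x∉ w∈)))
                      (chain ring) (chain′ (chain-++⁻ʳ xs (chain ring)))
      ; prev-next = λ w∈ → prev-next′ (∈-insert⁻ xs w∈)
      ; unique    = allPairs-insert xs (All.tabulate (λ w∈ → ≢e (∈-++⁺ˡ w∈))) (≢e x∈)
                      (All.tabulate (λ w∈ e≡w → ≢e (∈-++⁺ʳ xs (there w∈)) (sym e≡w)))
                      (unique ring)
      }
      where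
      M = xs ++ x ∷ ys
      nextₑ = update _≟_ next e z
      prevₑ = update _≟_ prev e x
      next′ = update _≟_ nextₑ x e
      prev′ = update _≟_ prevₑ z e

      x∉ = unique-split xs (unique ring)

      x∈ : x ∈ M
      x∈ = ∈-++⁺ʳ xs (here refl)

      ≢e : ∀ {w} → w ∈ M → w ≢ e
      ≢e w∈ refl = e∉ w∈

      next′-e : next′ e ≡ z
      next′-e = trans (update-≢ nextₑ (λ e≡x → ≢e x∈ (sym e≡x))) (update-≡ next refl)

      next′-other : ∀ {w} → w ∈ M → w ≢ x → next′ w ≡ next w
      next′-other w∈ w≢x = trans (update-≢ nextₑ w≢x) (update-≢ next (≢e w∈))

      chain′ : Chain next (x ∷ ys) q → Chain next′ (x ∷ e ∷ ys) q
      chain′ (nx ∷ ch) =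
        update-≡ nextₑ refl ∷ trans next′-e (trans (sym nx≡z) nx) ∷
        chain-cong (λ w∈ → sym (next′-other (∈-++⁺ʳ xs (there w∈)) (proj₂ x∉ w∈))) ch

      prev-next′ : ∀ {w} → w ≡ e ⊎ w ∈ M → prev′ (next′ w) ≡ w
      prev-next′ (inj₁ refl) = trans (cong prev′ next′-e) (update-≡ prevₑ refl)
      prev-next′ {w} (inj₂ w∈) with w ≟ x
      ... | yes refl = trans (update-≢ prevₑ e≢z) (update-≡ prev refl)
        where
        e≢z : e ≢ z
        e≢z refl = ≢e (next-∈ ring x∈) nx≡z
      ... | no w≢x = trans (cong prev′ (update-≢ next (≢e w∈)))
        (trans (update-≢ prevₑ nw≢z) (trans (update-≢ prev (≢e (next-∈ ring w∈))) (prev-next ring w∈)))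
        where
        -- `next` is injective on the circle, so only `x` has `z` as successor, and the changed
        -- `prev` field of `z` does not affect `w`.
        nw≢z : next w ≢ z
        nw≢z nw≡z = w≢x (trans (sym (prev-next ring w∈))
          (trans (cong prev (trans nw≡z (sym nx≡z))) (prev-next ring x∈)))

    circular-delete : ∀ xs {x e ys} → Circular next prev (xs ++ x ∷ e ∷ ys) →
                      Circular (update _≟_ next (prev e) (next e))
                               (update _≟_ prev (next e) (prev e))
                               (xs ++ x ∷ ys)
    circular-delete xs {x} {e} {ys} ring rewrite proj₂ (prev-between xs ring) = record
      { starts    = trans (head-++-∷ xs) (starts ring)
      ; chain     = chain-replace xs (λ w∈ → sym (update-≢ next (proj₁ x∉ w∈)))
                      (chain ring) (chain′ (chain-++⁻ʳ xs (chain ring)))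
      ; prev-next = prev-next′
      ; unique    = unique′
      }
      where
      unique′ = allPairs-delete xs (unique ring)
      next′ = update _≟_ next x (next e)
      prev′ = update _≟_ prev (next e) x

      x∉ = unique-split xs unique′
      -- The list is regrouped so that `e` becomes the point of splitting.
      e∉ = unique-split (xs ++ x ∷ [])
        (subst (AllPairs _≢_) (sym (++-assoc xs (x ∷ []) (e ∷ ys))) (unique ring))

      chain′ : Chain next (x ∷ e ∷ ys) q → Chain next′ (x ∷ ys) q
      chain′ (_ ∷ ne ∷ ch) =
        trans (update-≡ next refl) ne ∷ chain-cong (λ w∈ → sym (update-≢ next (proj₂ x∉ w∈))) ch

      ≢e : ∀ {w} → w ∈ xs ++ x ∷ ys → w ≢ e
      ≢e w∈ with ∈-++⁻ xs w∈
      ... | inj₁ w∈xs         = proj₁ e∉ (∈-++⁺ˡ w∈xs)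
      ... | inj₂ (here w≡x)   = proj₁ e∉ (∈-++⁺ʳ xs (here w≡x))
      ... | inj₂ (there w∈ys) = proj₂ e∉ w∈ys

      prev-next′ : ∀ {w} → w ∈ xs ++ x ∷ ys → prev′ (next′ w) ≡ w
      prev-next′ {w} w∈ with w ≟ x
      ... | yes refl = update-≡ prev refl
      ... | no _     = trans (update-≢ prev nw≢ne) (prev-next ring (∈-insert⁺ xs w∈))
        where
        nw≢ne : next w ≢ next e
        nw≢ne nw≡ne = ≢e w∈ (trans (sym (prev-next ring (∈-insert⁺ xs w∈)))
          (trans (cong prev nw≡ne) (prev-next ring (∈-++⁺ʳ xs (there (here refl))))))

-- The last element of a list with a given key.

module LastWithKey {a} {A : Set a} (key : A → ℤ) where
  open import Data.Bool using (if_then_else_)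
  open import Data.Empty using (⊥-elim)
  open import Data.Integer using (_≟_)
  open import Data.List using (List; []; _∷_; _++_)
  open import Data.List.Membership.Propositional using (_∈_)
  open import Data.List.Relation.Unary.Any using (here; there)
  open import Data.Maybe using (Maybe; just; nothing; _<∣>_)
  open import Data.Product using (∃₂; _×_; _,_)
  open import Relation.Binary.PropositionalEquality
  open import Relation.Nullary using (yes; no; does)

  private variable
    k : ℤ
    x : A

  lastWith : ℤ → List A → Maybe A
  lastWith k []       = nothing
  lastWith k (x ∷ xs) = lastWith k xs <∣> (if does (key x ≟ k) then just x else nothing)

  lastWith-++-cong : ∀ k zs xs ys → lastWith k xs ≡ lastWith k ys →
                     lastWith k (zs ++ xs) ≡ lastWith k (zs ++ ys)
  lastWith-++-cong k []       xs ys eq = eq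
  lastWith-++-cong k (z ∷ zs) xs ys eq = cong (_<∣> _) (lastWith-++-cong k zs xs ys eq)

  lastWith-++-just : ∀ k zs xs → lastWith k xs ≡ just x → lastWith k (zs ++ xs) ≡ just x
  lastWith-++-just k []       xs eq = eq
  lastWith-++-just k (z ∷ zs) xs eq = cong (_<∣> _) (lastWith-++-just k zs xs eq)

  lastWith-∷-≢ : ∀ xs → key x ≢ k → lastWith k (x ∷ xs) ≡ lastWith k xs
  lastWith-∷-≢ {x = x} {k} xs x≢k with lastWith k xs | key x ≟ k
  ... | just _  | _       = refl
  ... | nothing | yes x≡k = ⊥-elim (x≢k x≡k)
  ... | nothing | no _    = refl

  lastWith-∷-≡ : ∀ xs → key x ≡ k → lastWith k xs ≡ nothing → lastWith k (x ∷ xs) ≡ just x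
  lastWith-∷-≡ {x = x} {k} xs x≡k none rewrite none with key x ≟ k
  ... | yes _  = refl
  ... | no x≢k = ⊥-elim (x≢k x≡k)

  lastWith-nothing⁺ : ∀ k xs → (∀ {x} → x ∈ xs → key x ≢ k) → lastWith k xs ≡ nothing
  lastWith-nothing⁺ k []       _   = refl
  lastWith-nothing⁺ k (x ∷ xs) all =
    trans (lastWith-∷-≢ xs (all (here refl))) (lastWith-nothing⁺ k xs (λ x∈ → all (there x∈)))

  lastWith-nothing⁻ : ∀ k xs → lastWith k xs ≡ nothing → x ∈ xs → key x ≢ k
  lastWith-nothing⁻ k (y ∷ xs) none x∈ with lastWith k xs in eq | key y ≟ k
  lastWith-nothing⁻ k (y ∷ xs) none (here refl) | nothing | no y≢k = y≢k
  lastWith-nothing⁻ k (y ∷ xs) none (there x∈)  | nothing | no _   = lastWith-nothing⁻ k xs eq x∈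

  lastWith-just⁻ : ∀ k xs → lastWith k xs ≡ just x → key x ≡ k ×
                   ∃₂ λ ys zs → xs ≡ ys ++ x ∷ zs × lastWith k zs ≡ nothing
  lastWith-just⁻ k (y ∷ xs) eq with lastWith k xs in eq′
  lastWith-just⁻ k (y ∷ xs) refl | just _ with lastWith-just⁻ k xs eq′
  ... | x≡k , ys , zs , refl , none = x≡k , y ∷ ys , zs , refl , none
  lastWith-just⁻ k (y ∷ xs) eq   | nothing with key y ≟ k
  lastWith-just⁻ k (y ∷ xs) refl | nothing | yes y≡k = y≡k , [] , xs , refl , eq′

  -- This lemma and the next give the two reasons why adding or removing `y` leaves a table entry
  -- correct: `y` lies in another slot, or a later element lies in the same slot.
  lastWith-insert-≢ : ∀ k xs {x y} ys → key y ≢ k →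
                      lastWith k (xs ++ x ∷ y ∷ ys) ≡ lastWith k (xs ++ x ∷ ys)
  lastWith-insert-≢ k xs {x} {y} ys y≢k = lastWith-++-cong k xs (x ∷ y ∷ ys) (x ∷ ys)
    (lastWith-++-cong k (x ∷ []) (y ∷ ys) ys (lastWith-∷-≢ ys y≢k))

  lastWith-insert-just : ∀ k xs {x y z} ys → lastWith k ys ≡ just z →
                         lastWith k (xs ++ x ∷ y ∷ ys) ≡ lastWith k (xs ++ x ∷ ys)
  lastWith-insert-just k xs {x} {y} ys found = lastWith-++-cong k xs (x ∷ y ∷ ys) (x ∷ ys)
    (lastWith-++-cong k (x ∷ []) (y ∷ ys) ys (trans (lastWith-++-just k (y ∷ []) ys found) (sym found)))

-- Slot numbers and well-formed states of the queue.

module Queue {c ℓ a} (R : RealNumbers c ℓ)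
             (Elem : Set a) (_≟_ : DecidableEquality Elem) (q : Elem)
             (pmin pmax pΔ : RealNumbers.Carrier R) (r : ℕ)
             (0<pΔ : RealNumbers._<_ R (RealNumbers.0# R) pΔ)
             (range/pΔ : RealNumbers._≈_ R (RealNumbers._/_ R (RealNumbers._-_ R pmax pmin) pΔ)
                                           (RealNumbers.fromℕ R r)) where
  open RealNumbers R
  open MRPQ R Elem _≟_ q pmin pmax pΔ r
  open State
  open Floor R
  open FloorProperties R
  open ListProperties
  open CircularList _≟_ q
  open ScanDownProperties
  open UpdateProperties using (update-≡; update-≢)
  open import Algebra.Properties.Ring ring using (-‿+-comm; -‿involutive)
  open import Data.Bool using (if_then_else_)
  open import Data.Empty using (⊥-elim)
  open import Data.Fin as Fin using (Fin; toℕ)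
  import Data.Fin.Properties as Fin
  open import Data.Integer as ℤ using (+_)
  import Data.Integer.Properties as ℤ
  open import Data.List using (List; []; _∷_; _++_; head)
  open import Data.List.Membership.Propositional using (_∈_; _∉_)
  open import Data.List.Membership.Propositional.Properties using (∈-++⁺ʳ; ∈-++⁻; ∈-∃++)
  open import Data.List.Relation.Unary.All as All using ([])
  open import Data.List.Relation.Unary.AllPairs using (AllPairs; []; _∷_)
  open import Data.List.Relation.Unary.Any using (here; there)
  open import Data.Maybe using (Maybe; just; nothing)
  import Data.Maybe.Properties as Maybe
  open import Data.Maybe.Relation.Unary.Any using (just)
  import Data.Nat as ℕ
  import Data.Nat.Properties as ℕ
  open import Data.Product using (∃; _×_; _,_; proj₁; proj₂)
  open import Data.Sum using (_⊎_; inj₁; inj₂)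
  open import Function using (case_of_)
  open import Level using (_⊔_)
  open import Relation.Binary.PropositionalEquality as ≡ using (_≡_; _≢_)
  open import Relation.Nullary using (¬_; yes; no; does)
  open import Relation.Binary.Reasoning.StrictPartialOrder strictPartialOrder

  -- The sentinel lies exactly `pΔ` below `pmin`, which adds `pΔ / pΔ ≈ 1#` to the quotient.
  [p-[pmin-pΔ]]/pΔ : ∀ {p p₀} → p₀ ≈ pmin - pΔ → (p - p₀) / pΔ ≈ (p - pmin) / pΔ + 1#
  [p-[pmin-pΔ]]/pΔ {p} {p₀} p₀≈ = begin-equality
    (p - p₀) / pΔ                     ≈⟨ *-congʳ (+-congˡ (-‿cong p₀≈)) ⟩
    (p - (pmin - pΔ)) / pΔ            ≈⟨ *-congʳ (+-congˡ (-‿+-comm pmin (- pΔ))) ⟨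
    (p + (- pmin + - - pΔ)) / pΔ      ≈⟨ *-congʳ (+-congˡ (+-congˡ (-‿involutive pΔ))) ⟩
    (p + (- pmin + pΔ)) / pΔ          ≈⟨ *-congʳ (+-assoc p (- pmin) pΔ) ⟨
    (p - pmin + pΔ) / pΔ              ≈⟨ distribʳ (pΔ ⁻¹) (p - pmin) pΔ ⟩
    (p - pmin) / pΔ + pΔ / pΔ         ≈⟨ +-congˡ (x*x⁻¹≈1 0<pΔ) ⟩
    (p - pmin) / pΔ + 1#              ∎

  qltSlot-sentinel : ∀ σ → qltSlot σ q ≡ + 0
  qltSlot-sentinel σ = ⌊⌋-zero (begin-equality
    (prio σ q - prio σ q) / pΔ  ≈⟨ *-congʳ (-‿inverseʳ (prio σ q)) ⟩
    0# / pΔ                     ≈⟨ zeroˡ (pΔ ⁻¹) ⟩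
    0#                          ∎)

  qltSlot-suc : ∀ σ e → prio σ q ≈ pmin - pΔ → qltSlot σ e ≡ ℤ.suc ⌊ (prio σ e - pmin) / pΔ ⌋
  qltSlot-suc σ e prio-q = ⌊⌋-suc ([p-[pmin-pΔ]]/pΔ prio-q)

  -- The slots from 1 to `r`: within the table, and visibly different from slot 0 of the sentinel.
  HasSlot : State → Elem → Set
  HasSlot σ e = ∃ λ n → qltSlot σ e ≡ + ℕ.suc n × n ℕ.< r

  -- Dividing `pmin ≤ p < pmax` by `pΔ` after subtracting `pmin` gives a quotient in `[0, r)`, so
  -- its floor is at most `r - 1` and the slot is at most `r`.
  inRange⇒hasSlot : ∀ σ e → prio σ q ≈ pmin - pΔ → InRange (prio σ e) → HasSlot σ e
  inRange⇒hasSlot σ e prio-q (pmin≤p , p<pmax) with ⌊⌋-bounds 0≤y y<r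
    where
    y = (prio σ e - pmin) / pΔ
    0≤y : 0# ≤ y
    0≤y = begin
      0#                  ≈⟨ zeroˡ (pΔ ⁻¹) ⟨
      0# / pΔ             ≈⟨ *-congʳ (-‿inverseʳ pmin) ⟨
      (pmin - pmin) / pΔ  ≤⟨ *-monoˡ-≤ (⁻¹-pos 0<pΔ) (+-monoˡ-≤ (- pmin) pmin≤p) ⟩
      y                   ∎
    y<r : y < fromℕ r
    y<r = begin-strict
      y                   <⟨ *-monoˡ-< (⁻¹-pos 0<pΔ) (+-monoˡ-< (- pmin) p<pmax) ⟩
      (pmax - pmin) / pΔ  ≈⟨ range/pΔ ⟩
      fromℕ r             ∎
  ... | n , ⌊y⌋≡n , n<r = n , ≡.trans (qltSlot-suc σ e prio-q) (≡.cong ℤ.suc ⌊y⌋≡n) , n<r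

  toIndex-just : ∀ {n k} → k ≡ + n → n ℕ.≤ r → ∃ λ s → toIndex k ≡ just s × toℕ s ≡ n
  toIndex-just {n} ≡.refl n≤r with n ℕ.<? ℕ.suc r
  ... | yes n<1+r = Fin.fromℕ< n<1+r , ≡.refl , Fin.toℕ-fromℕ< n<1+r
  ... | no  n≮1+r = ⊥-elim (n≮1+r (ℕ.s≤s n≤r))

  lastIn : State → ℤ → List Elem → Maybe Elem
  lastIn σ = LastWithKey.lastWith (qltSlot σ)

  -- The strengthened induction hypothesis. `sorted` yields the MR-PQ invariant, `table` is what
  -- makes the routines keep the list sorted, and `hasSlot` keeps the table access of EXTRACT in
  -- bounds.
  record WellFormed (σ : State) (M : List Elem) : Set (a ⊔ ℓ) where
    field
      prio-q  : prio σ q ≈ pmin - pΔ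
      circle  : Circular (next σ) (prev σ) M
      sorted  : AllPairs (λ x y → qltSlot σ x ℤ.≤ qltSlot σ y) M
      hasSlot : ∀ {x} → x ∈ M → x ≢ q → HasSlot σ x
      table   : ∀ i → qlt σ i ≡ lastIn σ (+ toℕ i) M

  open WellFormed

  wellFormed-build : ∀ σ → WellFormed (build σ) (q ∷ [])
  wellFormed-build σ = record
    { prio-q  = reflexive (update-≡ _≟_ (prio σ) ≡.refl)
    ; circle  = record
      { starts    = ≡.refl
      ; chain     = next-q ∷ []
      ; prev-next = λ { (here ≡.refl) → ≡.trans (≡.cong (prev (build σ)) next-q)
                                                (update-≡ _≟_ (prev σ) ≡.refl) }
      ; unique    = [] ∷ []
      }
    ; sorted  = [] ∷ []
    ; hasSlot = λ { (here x≡q) x≢q → ⊥-elim (x≢q x≡q) }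
    ; table   = table′
    }
    where
    open LastWithKey (qltSlot (build σ))
    next-q : next (build σ) q ≡ q
    next-q = update-≡ _≟_ (next σ) ≡.refl
    slot-q = qltSlot-sentinel (build σ)
    table′ : ∀ i → qlt (build σ) i ≡ lastWith (+ toℕ i) (q ∷ [])
    table′ Fin.zero    = ≡.sym (lastWith-∷-≡ [] slot-q ≡.refl)
    table′ (Fin.suc i) = ≡.sym (lastWith-∷-≢ [] (λ eq → case ≡.trans (≡.sym slot-q) eq of λ ()))

  -- Dequeue order as position in the list.

  module _ {σ M} (wf : WellFormed σ M) where
    private module C = Circular (circle wf)

    -- The index is shifted by one because position zero of `M` is taken by the sentinel.
    dequeuedAt⇒[]= : ∀ {k e} → DequeuedAt σ k e → M [ ℕ.suc k ]= e
    dequeuedAt⇒[]= (first ≡.refl e≢q)   = chain-[]=-suc C.chain (head⇒[]= C.starts) e≢q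
    dequeuedAt⇒[]= (later d ≡.refl e≢q) = chain-[]=-suc C.chain (dequeuedAt⇒[]= d) e≢q

    []=-suc⇒≢q : ∀ {k e} → M [ ℕ.suc k ]= e → e ≢ q
    []=-suc⇒≢q p ≡.refl = unique-index C.unique (head⇒[]= C.starts) p
      where
      unique-index : ∀ {N k} {x : Elem} → AllPairs _≢_ N → N [ 0 ]= x → ¬ N [ ℕ.suc k ]= x
      unique-index (x∉ ∷ _) here (there p) = All.lookup x∉ ([]=⇒∈ p) ≡.refl

    []=⇒dequeuedAt : ∀ k {e} → M [ ℕ.suc k ]= e → DequeuedAt σ k e
    []=⇒dequeuedAt k p with chain-[]=-pred C.chain p
    []=⇒dequeuedAt ℕ.zero p | z , p′ , nz≡e with []=-functional p′ (head⇒[]= C.starts)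
    ... | ≡.refl = first nz≡e ([]=-suc⇒≢q p)
    []=⇒dequeuedAt (ℕ.suc k) p | z , p′ , nz≡e = later ([]=⇒dequeuedAt k p′) nz≡e ([]=-suc⇒≢q p)

    ∈⇒inList : ∀ {e} → e ∈ M → InList σ e
    ∈⇒inList e∈ with ∈⇒[]= e∈
    ... | ℕ.zero  , p = inj₁ ([]=-functional p (head⇒[]= C.starts))
    ... | ℕ.suc k , p = inj₂ (k , []=⇒dequeuedAt k p)

    inList⇒∈ : ∀ {e} → InList σ e → e ∈ M
    inList⇒∈ (inj₁ ≡.refl)  = C.q∈
    inList⇒∈ (inj₂ (_ , d)) = []=⇒∈ (dequeuedAt⇒[]= d)

    -- Slots are the floors of the invariant plus one, so the slots are strictly ordered too, and a
    -- list sorted by slot must then have `eᵢ` in front of `eⱼ`.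
    wellFormed⇒invariant : Invariant σ
    wellFormed⇒invariant {eᵢ = eᵢ} {eⱼ} dᵢ dⱼ _ _ ⌊pᵢ⌋<⌊pⱼ⌋ =
      ℕ.s<s⁻¹ (allPairs⇒< (sorted wf) (dequeuedAt⇒[]= dᵢ) (dequeuedAt⇒[]= dⱼ)
        (λ { ≡.refl → ℤ.<-irrefl ≡.refl slotᵢ<slotⱼ }) (ℤ.<⇒≱ slotᵢ<slotⱼ))
      where
      slotᵢ<slotⱼ : qltSlot σ eᵢ ℤ.< qltSlot σ eⱼ
      slotᵢ<slotⱼ = ≡.subst₂ ℤ._<_ (≡.sym (qltSlot-suc σ eᵢ (prio-q wf)))
        (≡.sym (qltSlot-suc σ eⱼ (prio-q wf)))
        (ℤ.+-monoʳ-< (+ 1) ⌊pᵢ⌋<⌊pⱼ⌋)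

  -- INSERT and EXTRACT preserve well-formedness.

  module _ {σ : State} where
    open LastWithKey (qltSlot σ)

    -- Shared by both branches of INSERT, which differ in the table `t`. Linking changes no
    -- priority, so `qltSlot` is definitionally the same before and after.
    wellFormed-link : ∀ xs {x e z ys} t → WellFormed σ (xs ++ x ∷ ys) → e ∉ xs ++ x ∷ ys →
      HasSlot σ e → next σ x ≡ z →
      qltSlot σ x ℤ.≤ qltSlot σ e → (∀ {y} → y ∈ ys → qltSlot σ e ℤ.≤ qltSlot σ y) →
      (∀ i → t i ≡ lastWith (+ toℕ i) (xs ++ x ∷ e ∷ ys)) →
      WellFormed (record (linkBetween σ e x z) { qlt = t }) (xs ++ x ∷ e ∷ ys)
    wellFormed-link xs {x} {e} t wf e∉ slot-e nx≡z x≤e e≤ys table′ = record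
      { prio-q  = prio-q wf
      ; circle  = circular-insert xs (circle wf) e∉ nx≡z
      ; sorted  = allPairs-insert xs
          (All.map (λ w≤x → ℤ.≤-trans w≤x x≤e) (proj₁ (allPairs-split xs (sorted wf))))
          x≤e (All.tabulate e≤ys) (sorted wf)
      ; hasSlot = λ w∈ → hasSlot′ (∈-insert⁻ xs w∈)
      ; table   = table′
      }
      where
      hasSlot′ : ∀ {w} → w ≡ e ⊎ w ∈ xs ++ x ∷ _ → w ≢ q → HasSlot σ w
      hasSlot′ (inj₁ ≡.refl) _   = slot-e
      hasSlot′ (inj₂ w∈)     w≢q = hasSlot wf w∈ w≢q

    wellFormed-unlink : ∀ xs {x e ys} t → WellFormed σ (xs ++ x ∷ e ∷ ys) →
      (∀ i → t i ≡ lastWith (+ toℕ i) (xs ++ x ∷ ys)) →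
      WellFormed (record (unlink σ e) { qlt = t }) (xs ++ x ∷ ys)
    wellFormed-unlink xs t wf table′ = record
      { prio-q  = prio-q wf
      ; circle  = circular-delete xs (circle wf)
      ; sorted  = allPairs-delete xs (sorted wf)
      ; hasSlot = λ w∈ → hasSlot wf (∈-insert⁺ xs w∈)
      ; table   = table′
      }

    -- `x` is the last element of the slot of `e`. Placed just before `x`, the new element stays
    -- within the order and `x` stays last in its slot, so the table remains correct.
    insert-before : ∀ {M s x e} → WellFormed σ M → e ∉ M → HasSlot σ e →
      qltSlot σ e ≡ + toℕ s → qlt σ s ≡ just x →
      ∃ (WellFormed (linkBetween σ e (prev σ x) x))
    insert-before {M} {s} {x} {e} wf e∉ slot-e@(_ , e≡1+n , _) e≡s qlt-s
      with lastWith-just⁻ (+ toℕ s) M (≡.trans (≡.sym (table wf s)) qlt-s)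
    ... | x≡s , xs , ys , ≡.refl , none
      with ++-∷-before xs (Circular.starts (circle wf)) x≢q
      where
      x≢q : x ≢ q
      -- The sentinel has slot 0, while `x` shares the slot of `e`, which is a successor.
      x≢q ≡.refl with () ← ≡.trans (≡.sym (qltSlot-sentinel σ)) (≡.trans x≡s (≡.trans (≡.sym e≡s) e≡1+n))
    ... | ws , w , M≡ = _ , ≡.subst (λ p → WellFormed (linkBetween σ e p x) (ws ++ w ∷ e ∷ x ∷ ys))
            (≡.sym (proj₂ (prev-between ws (circle wf′))))
            (wellFormed-link ws (qlt σ) wf′ (≡.subst (e ∉_) M≡ e∉) slot-e
              (proj₁ (prev-between ws (circle wf′)))
              (≡.subst (qltSlot σ w ℤ.≤_) x≡e (All.head (proj₂ (allPairs-split ws (sorted wf′)))))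
              e≤ table′)
      where
      wf′ : WellFormed σ (ws ++ w ∷ x ∷ ys)
      wf′ = ≡.subst (WellFormed σ) M≡ wf
      x≡e : qltSlot σ x ≡ qltSlot σ e
      x≡e = ≡.trans x≡s (≡.sym e≡s)
      e≤ : ∀ {y} → y ∈ x ∷ ys → qltSlot σ e ℤ.≤ qltSlot σ y
      e≤ (here ≡.refl) = ℤ.≤-reflexive (≡.sym x≡e)
      e≤ {y} (there y∈) = ≡.subst (ℤ._≤ qltSlot σ y) x≡e
        (All.lookup (proj₂ (allPairs-split xs (sorted wf))) y∈)
      table′ : ∀ i → qlt σ i ≡ lastWith (+ toℕ i) (ws ++ w ∷ e ∷ x ∷ ys)
      table′ i with qltSlot σ e ℤ.≟ + toℕ i
      ... | no e≢i  = ≡.trans (table wf′ i) (≡.sym (lastWith-insert-≢ (+ toℕ i) ws (x ∷ ys) e≢i))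
      ... | yes e≡i = ≡.trans (table wf′ i) (≡.sym (lastWith-insert-just (+ toℕ i) ws (x ∷ ys)
        (lastWith-∷-≡ ys (≡.trans x≡e e≡i)
          (≡.subst (λ k → lastWith k ys ≡ nothing) (≡.trans (≡.sym e≡s) e≡i) none))))

    -- `x` is last in slot `s′` and the slots from `s′ + 1` to `s` are empty, so everything behind
    -- `x` lies in slots above `s`.
    insert-after : ∀ {M s s′ x e} → WellFormed σ M → e ∉ M → HasSlot σ e →
      qltSlot σ e ≡ + toℕ s → qlt σ s′ ≡ just x → toℕ s′ ℕ.< toℕ s →
      (∀ i → toℕ s′ ℕ.< toℕ i → toℕ i ℕ.≤ toℕ s → qlt σ i ≡ nothing) →
      ∃ (WellFormed (setQlt (linkBetween σ e x (next σ x)) s (just e)))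
    insert-after {M} {s} {s′} {x} {e} wf e∉ slot-e e≡s qlt-s′ s′<s null
      with lastWith-just⁻ (+ toℕ s′) M (≡.trans (≡.sym (table wf s′)) qlt-s′)
    ... | x≡s′ , xs , ys , ≡.refl , none = _ ,
      wellFormed-link xs _ wf e∉ slot-e ≡.refl
        (≡.subst₂ ℤ._≤_ (≡.sym x≡s′) (≡.sym e≡s) (ℤ.+≤+ (ℕ.<⇒≤ s′<s)))
        (λ y∈ → ℤ.<⇒≤ (e< y∈)) table′
      where
      e< : ∀ {y} → y ∈ ys → qltSlot σ e ℤ.< qltSlot σ y
      e< {y} y∈ = ℤ.≰⇒> λ y≤e → between
        (≡.subst (ℤ._≤ qltSlot σ y) x≡s′ (All.lookup (proj₂ (allPairs-split xs (sorted wf))) y∈))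
        (≡.subst (qltSlot σ y ℤ.≤_) e≡s y≤e)
        ≡.refl
        where
        -- The slot of `y` is generalised to `k`, so that matching on the two bounds exposes it as a
        -- natural number `n` with `s′ ≤ n ≤ s`. The value `s′` is excluded because `x` is last
        -- there, the others because their entries are NULL.
        between : ∀ {k} → + toℕ s′ ℤ.≤ k → k ℤ.≤ + toℕ s → qltSlot σ y ≢ k
        between (ℤ.+≤+ {n = n} s′≤n) (ℤ.+≤+ n≤s) y≡n =
          lastWith-nothing⁻ (+ toℕ i) M (≡.trans (≡.sym (table wf i)) (null i s′<i i≤s))
            (∈-++⁺ʳ xs (there y∈)) (≡.trans y≡n (≡.cong +_ (≡.sym i≡n)))
          where
          n<1+r : n ℕ.< ℕ.suc r
          n<1+r = ℕ.≤-<-trans n≤s (Fin.toℕ<n s)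
          i = Fin.fromℕ< n<1+r
          i≡n : toℕ i ≡ n
          i≡n = Fin.toℕ-fromℕ< n<1+r
          s′<i : toℕ s′ ℕ.< toℕ i
          s′<i = ≡.subst (toℕ s′ ℕ.<_) (≡.sym i≡n)
            (ℕ.≤∧≢⇒< s′≤n (λ s′≡n → lastWith-nothing⁻ (+ toℕ s′) ys none y∈
              (≡.trans y≡n (≡.cong +_ (≡.sym s′≡n)))))
          i≤s : toℕ i ℕ.≤ toℕ s
          i≤s = ≡.subst (ℕ._≤ toℕ s) (≡.sym i≡n) n≤s
      table′ : ∀ i → update Fin._≟_ (qlt σ) s (just e) i ≡ lastWith (+ toℕ i) (xs ++ x ∷ e ∷ ys)
      table′ i with i Fin.≟ s
      ... | no i≢s = ≡.trans (table wf i) (≡.sym (lastWith-insert-≢ (+ toℕ i) xs ys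
        (λ e≡i → i≢s (Fin.toℕ-injective (ℤ.+-injective (≡.trans (≡.sym e≡i) e≡s))))))
      ... | yes ≡.refl = ≡.sym (lastWith-++-just (+ toℕ s) xs (x ∷ e ∷ ys)
        (lastWith-++-just (+ toℕ s) (x ∷ []) (e ∷ ys) (lastWith-∷-≡ ys e≡s
          (lastWith-nothing⁺ (+ toℕ s) ys (λ y∈ y≡s → ℤ.<-irrefl (≡.trans e≡s (≡.sym y≡s)) (e< y∈))))))

    -- `Any` over `Maybe` also asserts that the routine does not fault.
    wellFormed-insert : ∀ {M e} → WellFormed σ M → e ∉ M → InRange (prio σ e) →
                        Any (λ σ′ → ∃ (WellFormed σ′)) (insert σ e)
    wellFormed-insert {M} {e} wf e∉ inRange with inRange⇒hasSlot σ e (prio-q wf) inRange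
    ... | slot-e@(n , e≡1+n , n<r) with toIndex-just e≡1+n n<r
    ... | s , index , s≡1+n rewrite index with scanDown (qlt σ) s in scan
    -- The search cannot run past index 0: the sentinel is in the list with slot 0, so that entry is
    -- not NULL.
    ... | nothing = ⊥-elim (lastWith-nothing⁻ (+ 0) M
            (≡.trans (≡.sym (table wf Fin.zero)) (scanDown-nothing (qlt σ) s scan Fin.zero ℕ.z≤n))
            (Circular.q∈ (circle wf)) (qltSlot-sentinel σ))
    ... | just (s′ , x) with scanDown-just (qlt σ) s scan
    ... | qlt-s′ , s′≤s , null with s′ Fin.≟ s
    ...   | yes ≡.refl = just (insert-before wf e∉ slot-e (≡.trans e≡1+n (≡.cong +_ (≡.sym s≡1+n))) qlt-s′)
    ...   | no  s′≢s   = just (insert-after wf e∉ slot-e (≡.trans e≡1+n (≡.cong +_ (≡.sym s≡1+n))) qlt-s′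
              (ℕ.≤∧≢⇒< s′≤s (λ eq → s′≢s (Fin.toℕ-injective eq))) null)

    -- If the entry is not `e`, a later element of the slot keeps it correct. If it is `e`, then by
    -- sortedness the predecessor `x` either shares the slot and becomes its last element, or the
    -- slot is left empty.
    wellFormed-extract : ∀ {M e} → WellFormed σ M → e ∈ M → e ≢ q →
                         Any (λ σ′ → ∃ (WellFormed σ′)) (extract σ e)
    wellFormed-extract {M} {e} wf e∈ e≢q with hasSlot wf e∈ e≢q
    ... | n , e≡1+n , n<r with toIndex-just e≡1+n n<r | ∈-∃++ e∈
    ... | s , index , s≡1+n | zs , ys , ≡.refl
      with ++-∷-before zs (Circular.starts (circle wf)) e≢q
    ... | xs , x , M≡ rewrite index = result
      where
      σ₁ = unlink σ e
      k = + toℕ s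

      wf′ : WellFormed σ (xs ++ x ∷ e ∷ ys)
      wf′ = ≡.subst (WellFormed σ) M≡ wf

      e≡k : qltSlot σ e ≡ k
      e≡k = ≡.trans e≡1+n (≡.cong +_ (≡.sym s≡1+n))

      x≤e : qltSlot σ x ℤ.≤ qltSlot σ e
      x≤e = All.head (proj₂ (allPairs-split xs (sorted wf′)))

      prev-e : prev σ e ≡ x
      prev-e = proj₂ (prev-between xs (circle wf′))

      e≢x : e ≢ x
      e≢x e≡x = All.head (proj₂ (allPairs-split xs (Circular.unique (circle wf′)))) (≡.sym e≡x)

      -- EXTRACT reads `e.prev` after unlinking. The field would have been overwritten only if `e`
      -- were its own successor.
      prev₁-e : prev σ₁ e ≡ x
      prev₁-e = ≡.trans (update-≢ _≟_ (prev σ) e≢next) prev-e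
        where
        e≢next : e ≢ next σ e
        e≢next e≡ne = e≢x (≡.trans (≡.sym (Circular.prev-next (circle wf) e∈))
                                   (≡.trans (≡.cong (prev σ) (≡.sym e≡ne)) prev-e))

      lastWith-e : lastWith k ys ≡ nothing → lastWith k (xs ++ x ∷ e ∷ ys) ≡ just e
      lastWith-e none = lastWith-++-just k xs (x ∷ e ∷ ys)
        (lastWith-++-just k (x ∷ []) (e ∷ ys) (lastWith-∷-≡ ys e≡k none))

      -- A later element of the slot would have its last one recorded in the table, so that `e`
      -- would occur twice in the list.
      none-after : qlt σ s ≡ just e → lastWith k ys ≡ nothing
      none-after qlt-s with lastWith k ys in found
      ... | nothing = ≡.refl
      ... | just y with lastWith-just⁻ k ys found
                      | ≡.trans (≡.sym qlt-s) (≡.trans (table wf s)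
                          (lastWith-++-just k zs (e ∷ ys) (lastWith-++-just k (e ∷ []) ys found)))
      ...   | _ , us , vs , ≡.refl , _ | ≡.refl =
        ⊥-elim (proj₂ (unique-split zs (Circular.unique (circle wf))) (∈-++⁺ʳ us (here ≡.refl)) ≡.refl)

      table-set : ∀ {m} → m ≡ lastWith k (xs ++ x ∷ ys) →
                  ∀ i → update Fin._≟_ (qlt σ) s m i ≡ lastWith (+ toℕ i) (xs ++ x ∷ ys)
      table-set m≡ i with i Fin.≟ s
      ... | yes ≡.refl = m≡
      ... | no  i≢s    = ≡.trans (table wf′ i) (lastWith-insert-≢ (+ toℕ i) xs ys
        (λ e≡i → i≢s (Fin.toℕ-injective (ℤ.+-injective (≡.trans (≡.sym e≡i) e≡k)))))

      table-keep : qlt σ s ≢ just e → ∀ i → qlt σ i ≡ lastWith (+ toℕ i) (xs ++ x ∷ ys)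
      table-keep qlt-s≢e i with i Fin.≟ s
      ... | no  i≢s    = ≡.trans (table wf′ i) (lastWith-insert-≢ (+ toℕ i) xs ys
        (λ e≡i → i≢s (Fin.toℕ-injective (ℤ.+-injective (≡.trans (≡.sym e≡i) e≡k)))))
      ... | yes ≡.refl with lastWith k ys in found
      ...   | nothing = ⊥-elim (qlt-s≢e (≡.trans (table wf′ s) (lastWith-e found)))
      ...   | just _  = ≡.trans (table wf′ s) (lastWith-insert-just k xs ys found)

      x-last : qlt σ s ≡ just e → qltSlot σ x ≡ qltSlot σ e → just x ≡ lastWith k (xs ++ x ∷ ys)
      x-last qlt-s x≡e = ≡.sym (lastWith-++-just k xs (x ∷ ys)
        (lastWith-∷-≡ ys (≡.trans x≡e e≡k) (none-after qlt-s)))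

      -- The slot of `x` is strictly below `s`, hence so are those of all elements before it, and
      -- behind `e` nothing has slot `s`.
      none-left : qlt σ s ≡ just e → qltSlot σ x ≢ qltSlot σ e → nothing ≡ lastWith k (xs ++ x ∷ ys)
      none-left qlt-s x≢e = ≡.sym (lastWith-nothing⁺ k (xs ++ x ∷ ys) (λ w∈ → ≢k (∈-++⁻ xs w∈)))
        where
        x<k : qltSlot σ x ℤ.< k
        x<k = ≡.subst (qltSlot σ x ℤ.<_) e≡k (ℤ.≤∧≢⇒< x≤e x≢e)
        ≢k : ∀ {w} → w ∈ xs ⊎ w ∈ x ∷ ys → qltSlot σ w ≢ k
        ≢k (inj₁ w∈xs) w≡k = ℤ.<-irrefl w≡k
          (ℤ.≤-<-trans (All.lookup (proj₁ (allPairs-split xs (sorted wf′))) w∈xs) x<k)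
        ≢k (inj₂ (here ≡.refl)) w≡k = ℤ.<-irrefl w≡k x<k
        ≢k (inj₂ (there w∈ys))  = lastWith-nothing⁻ k ys (none-after qlt-s) w∈ys

      result : Any (λ σ′ → ∃ (WellFormed σ′)) (just (
        if does (Maybe.≡-dec _≟_ (qlt σ₁ s) (just e))
        then (if does (qltSlot σ₁ (prev σ₁ e) ℤ.≟ qltSlot σ₁ e)
              then setQlt σ₁ s (just (prev σ₁ e))
              else setQlt σ₁ s nothing)
        else σ₁))
      result with Maybe.≡-dec _≟_ (qlt σ s) (just e)
      ... | no  qlt-s≢e = just (_ , wellFormed-unlink xs (qlt σ) wf′ (table-keep qlt-s≢e))
      ... | yes qlt-s with qltSlot σ₁ (prev σ₁ e) ℤ.≟ qltSlot σ₁ e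
      ...   | yes p≡e = just (_ , wellFormed-unlink xs _ wf′ (table-set
                (≡.trans (≡.cong just prev₁-e)
                  (x-last qlt-s (≡.trans (≡.cong (qltSlot σ) (≡.sym prev₁-e)) p≡e)))))
      ...   | no  p≢e = just (_ , wellFormed-unlink xs _ wf′ (table-set
                (none-left qlt-s (λ x≡e → p≢e (≡.trans (≡.cong (qltSlot σ) prev₁-e) x≡e)))))

  -- Reachable states and the preservation theorem.

  wellFormed-run : ∀ {σ M} → WellFormed σ M → ∀ {call} → Valid σ call →
                   Any (λ σ′ → ∃ (WellFormed σ′)) (run σ call)
  wellFormed-run wf (validInsert e∉ inRange) = wellFormed-insert wf (λ e∈ → e∉ (∈⇒inList wf e∈)) inRange
  wellFormed-run wf (validExtract e≢q e∈)    = wellFormed-extract wf (inList⇒∈ wf e∈) e≢q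

  reachable⇒wellFormed : ∀ {σ} → Reachable σ → ∃ (WellFormed σ)
  reachable⇒wellFormed (built σ) = q ∷ [] , wellFormed-build σ
  reachable⇒wellFormed (called {σ} call reach valid eq) with reachable⇒wellFormed reach
  ... | _ , wf with wellFormed-run wf valid
  ... | any rewrite eq with just wf′ ← any = wf′

lemma1 : ∀ {c ℓ a} (R : RealNumbers c ℓ) → let open RealNumbers R in
    (pmin pmax pΔ : Carrier) (r : ℕ) →
    0# < pΔ → pmin < pmax → (pmax - pmin) / pΔ ≈ fromℕ r →
    (Elem : Set a) (_≟_ : DecidableEquality Elem) (q : Elem) →
    let open MRPQ R Elem _≟_ q pmin pmax pΔ r in
    ∀ σ → Reachable σ → Invariant σ →
    ∀ call → Valid σ call → Any Invariant (run σ call)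
lemma1 R pmin pmax pΔ r 0<pΔ _ range/pΔ Elem _≟_ q σ reach _ call valid =
  -- The state after the call is again well-formed, which implies the invariant.
  Any.map {Q = Invariant} (λ (_ , wf) → wellFormed⇒invariant wf)
    (wellFormed-run (proj₂ (reachable⇒wellFormed reach)) valid)
  where
  open MRPQ R Elem _≟_ q pmin pmax pΔ r
  open Queue R Elem _≟_ q pmin pmax pΔ r 0<pΔ range/pΔ
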